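{- Let $X$, $Y$ be graphs and let $\varphi:X\rightarrow Y$ be a complete orbit homomorphism. For $1\leq i\leq c(Y)$, let $y_i\in V_Y$ be such that $\mathcal{C}(Y)=\{C_Y(y_i):1\leq i\leq c(Y)\}$ and let $C_i\in\mathcal{C}(X)_{y_i}$. Then $$c(X)=\sum_{i=1}^{c(Y)}\frac{k_X(y_i)}{k_{C_i}(y_i)}.$$
   Context: All graphs are finite, undirected, simple and reflexive: a graph $X=(V_X,E_X)$ has a finite nonempty vertex set $V_X$, and $E_X$ consists of all loops $\{x\}$ ($x\in V_X$) together with a (possibly empty) set of $2$-element subsets of $V_X$. A homomorphism $\varphi:X\to Y$ is a map $\varphi:V_X\to V_Y$ such that $\{x_1,x_2\}\in E_X$ implies $\{\varphi(x_1),\varphi(x_2)\}\in E_Y$ (a proper edge may be mapped to a loop). It is complete if $\varphi(V_X)=V_Y$ and $\varphi(E_X)=E_Y$. It is an orbit homomorphism if there is a subgroup $\mathfrak{G}\leq\mathrm{Aut}(X)$ of graph automorphisms of $X$ such that the nonempty fibres $\varphi^{ -1}(y)$ are exactly the orbits of $\mathfrak{G}$ on $V_X$. A component of a graph is a maximal connected subgraph; $C_Y(y)$ is the component of $Y$ containing $y$, $\mathcal{C}(X)$ is the set of components of $X$, $c(X)=|\mathcal{C}(X)|$. For $y\in V_Y$ and a subgraph $\hat X$ of $X$, $k_{\hat X}(y)=|V_{\hat X}\cap\varphi^{ -1}(y)|$ (so $k_X(y)=|\varphi^{ -1}(y)|$), and $\mathcal{C}(X)_y=\{C\in\mathcal{C}(X):k_C(y)>0\}$.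 -}

module Defs where

open import Data.Bool.Properties using () renaming (_≟_ to _≟ᵇ_)
open import Data.Fin using (Fin)
open import Data.Fin.Permutation using (Permutation′; _⟨$⟩ʳ_; _∘ₚ_; flip) renaming (id to idₚ; _≈_ to _≈ₚ_)
open import Data.Fin.Properties using (_≟_; all?)
open import Data.Fin.Subset using (Subset; Nonempty; _∈_; _⊆_; _∩_; ⊤; ∣_∣; inside; outside)
open import Data.Fin.Subset.Properties using (_∈?_; _⊆?_; nonempty?)
open import Data.List using (List; []; _∷_; length; filter; allFin; cartesianProductWith)
open import Data.List.Membership.Propositional using () renaming (_∈_ to _∈ˡ_)
open import Data.List.Membership.Propositional.Properties using (∈-allFin; ∈-cartesianProductWith⁺; ∈-filter⁺; ∈-filter⁻)
open import Data.List.Relation.Unary.All as All using ()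
open import Data.List.Relation.Unary.AllPairs as AllPairs using ()
open import Data.List.Relation.Unary.Any using (here; there)
open import Data.List.Relation.Unary.Unique.Propositional using (Unique)
import Data.List.Relation.Unary.Unique.Propositional.Properties as Unique
open import Data.Nat using (ℕ; zero; suc; NonZero; _>_)
open import Data.Product using (_×_; _,_; proj₂; ∃-syntax)
open import Data.Rational.Properties using (+-0-commutativeMonoid)
open import Data.Sum using (_⊎_; inj₁; inj₂)
open import Data.Vec using (Vec; []; _∷_; lookup; tabulate)
open import Data.Vec.Properties using (≡-dec)
open import Function using (_∘_)
open import Function.Bundles using (_⇔_)
open import Function.Definitions using (StrictlySurjective)
open import Level using (0ℓ)
open import Relation.Binary.Construct.Closure.ReflexiveTransitive using (Star; ε; _◅_; _◅◅_)
open import Relation.Binary.Core using (Rel)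
open import Relation.Binary.Definitions using (Decidable; DecidableEquality; Reflexive; Symmetric)
open import Relation.Binary.PropositionalEquality using (_≡_; refl)
open import Relation.Nullary using (does; _×-dec_; _⊎-dec_; _→-dec_)
open import Relation.Nullary.Decidable using (map′)
open import Relation.Unary using (Pred; _≐_) renaming (Decidable to Decidable₁)

open import Algebra.Properties.CommutativeMonoid.Sum +-0-commutativeMonoid public using () renaming (sum to sumℚ)

private
  variable
    m n : ℕ

record Graph : Set₁ where
  field
    order    : ℕ
    .{{nonEmpty}} : NonZero order
    Adj      : Rel (Fin order) 0ℓ
    adj?     : Decidable Adj
    adj-refl : Reflexive Adj
    adj-sym  : Symmetric Adj

open Graph public

V : Graph → Set
V X = Fin (order X)

IsHomomorphism : (X Y : Graph) → (V X → V Y) → Set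
IsHomomorphism X Y φ = ∀ {x₁ x₂} → Adj X x₁ x₂ → Adj Y (φ x₁) (φ x₂)

-- For a homomorphism φ, the inclusion φ(E_X) ⊆ E_Y is automatic.  As Adj X is
-- symmetric, it does not matter which endpoint lies over which.
record IsComplete (X Y : Graph) (φ : V X → V Y) : Set where
  field
    onto-V : StrictlySurjective _≡_ φ
    onto-E : ∀ {y₁ y₂} → Adj Y y₁ y₂ →
             ∃[ x₁ ] ∃[ x₂ ] Adj X x₁ x₂ × φ x₁ ≡ y₁ × φ x₂ ≡ y₂

IsAutomorphism : (X : Graph) → Permutation′ (order X) → Set
IsAutomorphism X π = ∀ x₁ x₂ → Adj X x₁ x₂ ⇔ Adj X (π ⟨$⟩ʳ x₁) (π ⟨$⟩ʳ x₂)

-- Permutation′ carries inverses and proofs, so membership in the subgroup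
-- must be invariant under pointwise equality.
record IsSubgroupOfAut (X : Graph) (G : Pred (Permutation′ (order X)) 0ℓ) : Set where
  field
    automorphism : ∀ {π} → G π → IsAutomorphism X π
    resp-≈       : ∀ {π ρ} → π ≈ₚ ρ → G π → G ρ
    id-closed    : G idₚ
    ∘-closed     : ∀ {π ρ} → G π → G ρ → G (π ∘ₚ ρ)
    flip-closed  : ∀ {π} → G π → G (flip π)

Orbit : Pred (Permutation′ n) 0ℓ → Fin n → Pred (Fin n) 0ℓ
Orbit G x x′ = ∃[ π ] G π × π ⟨$⟩ʳ x ≡ x′

fibre : (Fin m → Fin n) → Fin n → Subset m
fibre φ y = tabulate λ x → does (φ x ≟ y)

IsOrbit : (X Y : Graph) → (V X → V Y) → Set₁
IsOrbit X Y φ = ∃[ G ] IsSubgroupOfAut X G ×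
  ((S : Subset (order X)) →
    (Nonempty S × ∃[ y ] S ≡ fibre φ y) ⇔ (∃[ x ] (_∈ S) ≐ Orbit G x))

-- Subgraph data are kept free of proofs, so that propositional equality is
-- equality of vertex sets and edge sets.  The x-th entry of nbrs is the set
-- of neighbours of x, and is empty unless x is a vertex of the subgraph.
record RawSubgraph (n : ℕ) : Set where
  constructor raw
  field
    vertices : Subset n
    nbrs     : Vec (Subset n) n

open RawSubgraph public

Edge : RawSubgraph n → Rel (Fin n) 0ℓ
Edge H x₁ x₂ = x₂ ∈ lookup (nbrs H) x₁

record IsSubgraph (X : Graph) (H : RawSubgraph (order X)) : Set where
  field
    nonempty    : Nonempty (vertices H)
    edge⇒adj    : ∀ x₁ x₂ → Edge H x₁ x₂ → Adj X x₁ x₂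
    edge⇒vertex : ∀ x₁ x₂ → Edge H x₁ x₂ → x₁ ∈ vertices H
    edge-sym    : ∀ x₁ x₂ → Edge H x₁ x₂ → Edge H x₂ x₁
    loops       : ∀ x → x ∈ vertices H → Edge H x x

whole : (X : Graph) → RawSubgraph (order X)
whole X = raw ⊤ (tabulate λ x₁ → tabulate λ x₂ → does (adj? X x₁ x₂))

_⊑_ : Rel (RawSubgraph n) 0ℓ
H ⊑ K = vertices H ⊆ vertices K × (∀ x → lookup (nbrs H) x ⊆ lookup (nbrs K) x)

IsConnected : RawSubgraph n → Set
IsConnected H = ∀ x₁ x₂ → x₁ ∈ vertices H → x₂ ∈ vertices H → Star (Edge H) x₁ x₂

IsConnectedSubgraph : (X : Graph) → RawSubgraph (order X) → Set
IsConnectedSubgraph X H = IsSubgraph X H × IsConnected H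

IsComponent : (X : Graph) → RawSubgraph (order X) → Set
IsComponent X H = IsConnectedSubgraph X H ×
  (∀ K → IsConnectedSubgraph X K → H ⊑ K → H ≡ K)

-- H is C_X(x).
IsComponentOf : (X : Graph) → V X → RawSubgraph (order X) → Set
IsComponentOf X x H = IsComponent X H × x ∈ vertices H

k : (Fin m → Fin n) → RawSubgraph m → Fin n → ℕ
k φ H y = ∣ vertices H ∩ fibre φ y ∣

-- H belongs to 𝒞(X)_y.
IsComponentMeeting : (X Y : Graph) → (V X → V Y) → V Y → RawSubgraph (order X) → Set
IsComponentMeeting X Y φ y H = IsComponent X H × k φ H y > 0

-- The number of components is obtained by filtering the list of all subgraph
-- data, which needs IsComponent to be decidable.  Walks are decided by the
-- Warshall recursion: Via R vs relates x to y when there is a walk from x to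
-- y whose intermediate vertices all belong to vs.

module _ (R : Rel (Fin n) 0ℓ) where

  Via : List (Fin n) → Rel (Fin n) 0ℓ
  Via []       x y = x ≡ y ⊎ R x y
  Via (v ∷ vs) x y = Via vs x y ⊎ (Via vs x v × Via vs v y)

  via? : Decidable R → ∀ vs → Decidable (Via vs)
  via? R? []       x y = (x ≟ y) ⊎-dec R? x y
  via? R? (v ∷ vs) x y = via? R? vs x y ⊎-dec (via? R? vs x v ×-dec via? R? vs v y)

  via⇒star : ∀ vs {x y} → Via vs x y → Star R x y
  via⇒star []       (inj₁ refl)    = ε
  via⇒star []       (inj₂ r)       = r ◅ ε
  via⇒star (v ∷ vs) (inj₁ p)       = via⇒star vs p
  via⇒star (v ∷ vs) (inj₂ (p , q)) = via⇒star vs p ◅◅ via⇒star vs q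

  via-base : ∀ vs {x y} → x ≡ y ⊎ R x y → Via vs x y
  via-base []       b = b
  via-base (v ∷ vs) b = inj₁ (via-base vs b)

  via-join : ∀ vs {x w y} → w ∈ˡ vs → Via vs x w → Via vs w y → Via vs x y
  via-join (v ∷ vs) (here refl) p q = inj₂ (into p , out q)
    where
    into : ∀ {x} → Via (v ∷ vs) x v → Via vs x v
    into (inj₁ p)       = p
    into (inj₂ (p , _)) = p
    out : ∀ {y} → Via (v ∷ vs) v y → Via vs v y
    out (inj₁ q)       = q
    out (inj₂ (_ , q)) = q
  via-join (v ∷ vs) (there i) (inj₁ p)       (inj₁ q)        = inj₁ (via-join vs i p q)
  via-join (v ∷ vs) (there i) (inj₁ p)       (inj₂ (q , q′)) = inj₂ (via-join vs i p q , q′)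
  via-join (v ∷ vs) (there i) (inj₂ (p , p′)) (inj₁ q)        = inj₂ (p , via-join vs i p′ q)
  via-join (v ∷ vs) (there i) (inj₂ (p , _)) (inj₂ (_ , q′)) = inj₂ (p , q′)

  star⇒via : ∀ {x y} → Star R x y → Via (allFin n) x y
  star⇒via ε              = via-base (allFin n) (inj₁ refl)
  star⇒via (_◅_ {j = w} r rs) =
    via-join (allFin n) (∈-allFin w) (via-base (allFin n) (inj₂ r)) (star⇒via rs)

  star? : Decidable R → Decidable (Star R)
  star? R? x y = map′ (via⇒star (allFin n)) star⇒via (via? R? (allFin n) x y)

edge? : (H : RawSubgraph n) → Decidable (Edge H)
edge? H x₁ x₂ = x₂ ∈? lookup (nbrs H) x₁

isSubgraph? : (X : Graph) → Decidable₁ (IsSubgraph X)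
isSubgraph? X H = map′
  (λ (a , b , c , d , e) → record
    { nonempty = a ; edge⇒adj = b ; edge⇒vertex = c ; edge-sym = d ; loops = e })
  (λ h → let open IsSubgraph h in nonempty , edge⇒adj , edge⇒vertex , edge-sym , loops)
  (nonempty? (vertices H)
    ×-dec (all? λ x₁ → all? λ x₂ → edge? H x₁ x₂ →-dec adj? X x₁ x₂)
    ×-dec (all? λ x₁ → all? λ x₂ → edge? H x₁ x₂ →-dec (x₁ ∈? vertices H))
    ×-dec (all? λ x₁ → all? λ x₂ → edge? H x₁ x₂ →-dec edge? H x₂ x₁)
    ×-dec (all? λ x → (x ∈? vertices H) →-dec edge? H x x))

isConnectedSubgraph? : (X : Graph) → Decidable₁ (IsConnectedSubgraph X)
isConnectedSubgraph? X H = isSubgraph? X H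
  ×-dec (all? λ x₁ → all? λ x₂ →
    (x₁ ∈? vertices H) →-dec ((x₂ ∈? vertices H) →-dec star? (Edge H) (edge? H) x₁ x₂))

⊑? : Decidable (_⊑_ {n})
⊑? H K = (vertices H ⊆? vertices K)
  ×-dec (all? λ x → lookup (nbrs H) x ⊆? lookup (nbrs K) x)

≡? : DecidableEquality (RawSubgraph n)
≡? H K = map′ (λ { (refl , refl) → refl }) (λ { refl → refl , refl })
  (≡-dec _≟ᵇ_ (vertices H) (vertices K) ×-dec ≡-dec (≡-dec _≟ᵇ_) (nbrs H) (nbrs K))

module _ {A : Set} where

  vecs : List A → ∀ n → List (Vec A n)
  vecs xs zero    = [] ∷ []
  vecs xs (suc n) = cartesianProductWith _∷_ xs (vecs xs n)

  ∈-vecs : ∀ {xs} → (∀ a → a ∈ˡ xs) → (v : Vec A n) → v ∈ˡ vecs xs n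
  ∈-vecs all []      = here refl
  ∈-vecs all (a ∷ v) = ∈-cartesianProductWith⁺ _∷_ (all a) (∈-vecs all v)

  vecs-unique : ∀ {xs} → Unique xs → ∀ n → Unique (vecs xs n)
  vecs-unique u zero    = All.[] AllPairs.∷ AllPairs.[]
  vecs-unique u (suc n) =
    Unique.cartesianProductWith⁺ _∷_ (λ { refl → refl , refl }) u (vecs-unique u n)

subsets : ∀ n → List (Subset n)
subsets = vecs (outside ∷ inside ∷ [])

∈-subsets : (S : Subset n) → S ∈ˡ subsets n
∈-subsets = ∈-vecs λ { outside → here refl ; inside → there (here refl) }

subsets-unique : ∀ n → Unique (subsets n)
subsets-unique = vecs-unique
  (((λ ()) All.∷ All.[]) AllPairs.∷ All.[] AllPairs.∷ AllPairs.[])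

rawSubgraphs : ∀ n → List (RawSubgraph n)
rawSubgraphs n = cartesianProductWith raw (subsets n) (vecs (subsets n) n)

∈-rawSubgraphs : (H : RawSubgraph n) → H ∈ˡ rawSubgraphs n
∈-rawSubgraphs H =
  ∈-cartesianProductWith⁺ raw (∈-subsets (vertices H)) (∈-vecs ∈-subsets (nbrs H))

rawSubgraphs-unique : ∀ n → Unique (rawSubgraphs n)
rawSubgraphs-unique n = Unique.cartesianProductWith⁺ raw (λ { refl → refl , refl })
  (subsets-unique n) (vecs-unique (subsets-unique n) n)

isComponent? : (X : Graph) → Decidable₁ (IsComponent X)
isComponent? X H = isConnectedSubgraph? X H ×-dec map′
  (λ maximal K → All.lookup maximal (∈-rawSubgraphs K))
  (λ maximal → All.tabulate λ {K} _ → maximal K)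
  (All.all? (λ K → isConnectedSubgraph? X K →-dec (⊑? H K →-dec ≡? H K))
            (rawSubgraphs (order X)))

components : (X : Graph) → List (RawSubgraph (order X))
components X = filter (isComponent? X) (rawSubgraphs (order X))

c : Graph → ℕ
c X = length (components X)

∈-components⁺ : (X : Graph) → ∀ {H} → IsComponent X H → H ∈ˡ components X
∈-components⁺ X {H} = ∈-filter⁺ (isComponent? X) (∈-rawSubgraphs H)

∈-components⁻ : (X : Graph) → ∀ {H} → H ∈ˡ components X → IsComponent X H
∈-components⁻ X = proj₂ ∘ ∈-filter⁻ (isComponent? X) {xs = rawSubgraphs (order X)}

components-unique : (X : Graph) → Unique (components X)
components-unique X = Unique.filter⁺ (isComponent? X) (rawSubgraphs-unique (order X))

{-# OPTIONS --safe #-}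
-- By path lifting along φ, a component of X meets the fibre over y exactly when
-- its image lies in the component of y, so each component of X meets the fibre
-- over exactly one yᵢ.  The group 𝔊 permutes the components meeting the fibre over
-- yᵢ transitively and preserves that fibre, hence all of them meet it in the same
-- number k_{Cᵢ}(yᵢ) of points; there are thus k_X(yᵢ) / k_{Cᵢ}(yᵢ) of them.
module Submission where

open import Defs
open import Data.Bool using (if_then_else_)
open import Data.Fin using (Fin; zero; suc; punchIn; punchOut)
open import Data.Fin.Permutation using (Permutation′; _⟨$⟩ʳ_; _∘ₚ_; flip; inverseˡ)
open import Data.Fin.Properties using (_≟_; any?; injective⇒≤; punchInᵢ≢i; punchOut-injective)
open import Data.Fin.Subset using (Subset; Nonempty; _∈_; _∩_; ⊤; ∣_∣; inside; outside)
open import Data.Fin.Subset.Properties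
  using (_∈?_; nonempty?; Empty-unique; ∣⊥∣≡0; ∈⊤; ⊆-antisym; x∈p∩q⁺; x∈p∩q⁻)
open import Data.Integer using (+_)
open import Data.Integer.Properties using (pos-*; pos-+) renaming (*-identityʳ to *ℤ-identityʳ)
open import Data.List using (List; lookup)
open import Data.List.Membership.Propositional.Properties using (∈-lookup)
open import Data.List.Relation.Unary.All as All using ()
open import Data.List.Relation.Unary.AllPairs using () renaming (_∷_ to _∷ₚ_)
open import Data.List.Relation.Unary.Any using (index)
open import Data.List.Relation.Unary.Any.Properties using (lookup-index)
open import Data.List.Relation.Unary.Unique.Propositional using (Unique)
open import Data.Nat using (ℕ; zero; suc; _+_; _*_; _<_; NonZero; >-nonZero)
open import Data.Nat.Properties
  using (+-0-commutativeMonoid; +-*-semiring; *-identityˡ; 1+n≰n; n≮0)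
open import Data.Product using (_×_; _,_; proj₁; proj₂; ∃-syntax)
open import Data.Rational as ℚ using (ℚ; _/_)
open import Data.Rational.Properties using (fromℚᵘ-cong; toℚᵘ-injective; toℚᵘ-fromℚᵘ; toℚᵘ-homo-+)
open import Data.Rational.Unnormalised as ℚᵘ using (mkℚᵘ; *≡*)
open import Data.Rational.Unnormalised.Properties as ℚᵘ using ()
open import Data.Vec as Vec using (tabulate)
open import Data.Vec.Properties
  using ([]=⇒lookup; lookup⇒[]=; lookup∘tabulate; tabulate∘lookup; tabulate-cong)
open import Function using (_∘_)
open import Function.Bundles using (_⇔_; mk⇔; Equivalence)
open import Function.Definitions using (Injective; StrictlySurjective)
open import Level using (0ℓ)
open import Relation.Binary.Construct.Closure.ReflexiveTransitive
  using (Star; ε; _◅_; _◅◅_; gmap; reverse) renaming (map to mapStar)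
open import Relation.Binary.PropositionalEquality
open import Relation.Nullary using (¬_; Dec; yes; no; does; _×-dec_; contradiction)
open import Relation.Nullary.Decidable using (does-⇔; dec-true; dec-false)
open import Relation.Unary using (Pred; _≐_) renaming (Decidable to Decidable₁)

open import Algebra.Properties.CommutativeMonoid.Sum +-0-commutativeMonoid
  using (sum-remove; ∑-comm; sum-permute)
open import Algebra.Properties.Semiring.Sum +-*-semiring
  using (sum; sum-cong-≗; sum-replicate-zero; *-distribʳ-sum)

open Equivalence using (to; from)
open ≡-Reasoning

private
  variable
    m n : ℕ

-- Counting by indicators

𝟙 : {P : Set} → Dec P → ℕ
𝟙 P? = if does P? then 1 else 0

𝟙-cong : {P Q : Set} → P ⇔ Q → (P? : Dec P) (Q? : Dec Q) → 𝟙 P? ≡ 𝟙 Q?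
𝟙-cong P⇔Q P? Q? = cong (if_then 1 else 0) (does-⇔ P⇔Q P? Q?)

𝟙-× : {P Q : Set} (P? : Dec P) (Q? : Dec Q) → 𝟙 (P? ×-dec Q?) ≡ 𝟙 P? * 𝟙 Q?
𝟙-× (yes _) Q? = sym (*-identityˡ (𝟙 Q?))
𝟙-× (no _)  Q? = refl

𝟙-true : {P : Set} (P? : Dec P) → P → 𝟙 P? ≡ 1
𝟙-true P? p = cong (if_then 1 else 0) (dec-true P? p)

𝟙-false : {P : Set} (P? : Dec P) → ¬ P → 𝟙 P? ≡ 0
𝟙-false P? ¬p = cong (if_then 1 else 0) (dec-false P? ¬p)

-- Once the summand at `i` is split off, only zeros remain, since `punchIn i` never takes the value
-- `i`.
sum-𝟙-unique : {P : Pred (Fin n) 0ℓ} (P? : Decidable₁ P) →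
               ∀ i → P i → (∀ j → P j → j ≡ i) → sum (𝟙 ∘ P?) ≡ 1
sum-𝟙-unique {suc n} P? i p unique = begin
  sum (𝟙 ∘ P?)                              ≡⟨ sum-remove (𝟙 ∘ P?) ⟩
  𝟙 (P? i) + sum (𝟙 ∘ P? ∘ punchIn i)      ≡⟨ cong₂ _+_ (𝟙-true (P? i) p) (sum-cong-≗ others) ⟩
  1 + sum {n} (λ _ → 0)                     ≡⟨ cong suc (sum-replicate-zero n) ⟩
  1                                         ∎
  where
  others : ∀ j → 𝟙 (P? (punchIn i j)) ≡ 0
  others j = 𝟙-false (P? (punchIn i j)) (punchInᵢ≢i i j ∘ unique _)

sum-1 : ∀ n → sum {n} (λ _ → 1) ≡ n
sum-1 zero    = refl
sum-1 (suc n) = cong suc (sum-1 n)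

∣_∣≡sum : (S : Subset n) → ∣ S ∣ ≡ sum (λ x → 𝟙 (x ∈? S))
∣ Vec.[]            ∣≡sum = refl
∣ inside  Vec.∷ S ∣≡sum = cong suc ∣ S ∣≡sum
∣ outside Vec.∷ S ∣≡sum = ∣ S ∣≡sum

∈-tabulate : {P : Pred (Fin n) 0ℓ} (P? : Decidable₁ P) →
             ∀ {x} → x ∈ tabulate (does ∘ P?) ⇔ P x
∈-tabulate {P = P} P? {x} = mk⇔ into out
  where
  into : x ∈ tabulate (does ∘ P?) → P x
  -- The accompanying equation rules out the case `no`, where it would identify `outside` with
  -- `inside`.
  into x∈ with P? x | trans (sym (lookup∘tabulate (does ∘ P?) x)) ([]=⇒lookup x∈)
  ... | yes p | _ = p
  out : P x → x ∈ tabulate (does ∘ P?)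
  out p = lookup⇒[]= x _ (trans (lookup∘tabulate (does ∘ P?) x) (dec-true (P? x) p))

∈-fibre : (φ : Fin m → Fin n) → ∀ {x y} → x ∈ fibre φ y ⇔ φ x ≡ y
∈-fibre φ {y = y} = ∈-tabulate λ x → φ x ≟ y

-- In this form a count can be exchanged with a sum over components and reindexed by a permutation.
k≡sum : (φ : Fin m → Fin n) (H : RawSubgraph m) (y : Fin n) →
        k φ H y ≡ sum (λ x → 𝟙 (x ∈? vertices H) * 𝟙 (φ x ≟ y))
k≡sum φ H y = trans ∣ vertices H ∩ fibre φ y ∣≡sum (sum-cong-≗ λ x →
  trans (𝟙-cong (split x) (x ∈? _) (x ∈? vertices H ×-dec φ x ≟ y))
        (𝟙-× (x ∈? vertices H) (φ x ≟ y)))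
  where
  split : ∀ x → x ∈ vertices H ∩ fibre φ y ⇔ (x ∈ vertices H × φ x ≡ y)
  split x = mk⇔
    (λ x∈ → let a , b = x∈p∩q⁻ _ _ x∈ in a , to (∈-fibre φ) b)
    (λ (a , b) → x∈p∩q⁺ (a , from (∈-fibre φ) b))

-- Pigeonhole: if `i` were missed, punching it out of all values would inject `Fin (suc n)` into
-- `Fin n`.
injective⇒strictlySurjective : {f : Fin n → Fin n} →
  Injective _≡_ _≡_ f → StrictlySurjective _≡_ f
injective⇒strictlySurjective {suc n} {f} inj i with any? (λ j → f j ≟ i)
... | yes hit = hit
... | no miss = contradiction
  (injective⇒≤ {f = λ j → punchOut (avoids j)}
    (λ eq → inj (punchOut-injective (avoids _) (avoids _) eq)))
  1+n≰n
  where
  avoids : ∀ j → i ≢ f j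
  avoids j i≡fj = miss (j , sym i≡fj)

lookup-injective : {A : Set} {xs : List A} → Unique xs → Injective _≡_ _≡_ (lookup xs)
lookup-injective (_ ∷ₚ _) {zero}  {zero}  _  = refl
lookup-injective (a ∷ₚ _) {zero}  {suc j} eq = contradiction eq (All.lookup a (∈-lookup j))
lookup-injective (a ∷ₚ _) {suc i} {zero}  eq = contradiction (sym eq) (All.lookup a (∈-lookup i))
lookup-injective (_ ∷ₚ u) {suc i} {suc j} eq = cong suc (lookup-injective u eq)

-- Natural numbers inside ℚ

fromℕ : ℕ → ℚ
fromℕ n = + n / 1

-- The comparison takes place among unnormalised fractions, where no gcd has to be cancelled. The
-- second argument of `mkℚᵘ` is the denominator minus one, so 0 stands for denominator 1.
fromℕ-+ : ∀ m n → fromℕ (m + n) ≡ fromℕ m ℚ.+ fromℕ n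
fromℕ-+ m n = toℚᵘ-injective (ℚᵘ.≃-trans (toℚᵘ-fromℚᵘ (mkℚᵘ (+ (m + n)) 0))
  (ℚᵘ.≃-trans (*≡* numerators)
  (ℚᵘ.≃-sym (ℚᵘ.≃-trans (toℚᵘ-homo-+ (fromℕ m) (fromℕ n))
    (ℚᵘ.+-cong (toℚᵘ-fromℚᵘ (mkℚᵘ (+ m) 0)) (toℚᵘ-fromℚᵘ (mkℚᵘ (+ n) 0)))))))
  where
  open Data.Integer renaming (_+_ to _+ℤ_; _*_ to _*ℤ_)
  numerators : + (m + n) *ℤ + 1 ≡ (+ m *ℤ + 1 +ℤ + n *ℤ + 1) *ℤ + 1
  numerators = cong (_*ℤ + 1) (trans (pos-+ m n)
    (cong₂ _+ℤ_ (sym (*ℤ-identityʳ (+ m))) (sym (*ℤ-identityʳ (+ n)))))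

fromℕ-sum : (f : Fin n → ℕ) → fromℕ (sum f) ≡ sumℚ (fromℕ ∘ f)
fromℕ-sum {zero}  f = refl
fromℕ-sum {suc n} f = trans (fromℕ-+ (f zero) (sum (f ∘ suc)))
                            (cong (fromℕ (f zero) ℚ.+_) (fromℕ-sum (f ∘ suc)))

m*n/n≡fromℕ-m : ∀ m n .{{_ : NonZero n}} → + (m * n) / n ≡ fromℕ m
m*n/n≡fromℕ-m m n@(suc n-1) = fromℚᵘ-cong {mkℚᵘ (+ (m * n)) n-1} {mkℚᵘ (+ m) 0}
  (*≡* (trans (*ℤ-identityʳ (+ (m * n))) (pos-* m n)))

sumℚ-cong : {f g : Fin n → ℚ} → (∀ i → f i ≡ g i) → sumℚ f ≡ sumℚ g
sumℚ-cong {zero}  f≗g = refl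
sumℚ-cong {suc n} f≗g = cong₂ ℚ._+_ (f≗g zero) (sumℚ-cong (f≗g ∘ suc))

-- Components as classes of connectedness

Connected : (X : Graph) → V X → V X → Set
Connected X = Star (Adj X)

connected-sym : (X : Graph) → ∀ {x y} → Connected X x y → Connected X y x
connected-sym X = reverse (adj-sym X)

⊑-antisym : {H K : RawSubgraph n} → H ⊑ K → K ⊑ H → H ≡ K
⊑-antisym {H = raw _ as} {raw _ bs} (v , e) (v′ , e′) = cong₂ raw (⊆-antisym v v′) (begin
  as                          ≡⟨ tabulate∘lookup as ⟨
  tabulate (Vec.lookup as)    ≡⟨ tabulate-cong (λ x → ⊆-antisym (e x) (e′ x)) ⟩
  tabulate (Vec.lookup bs)    ≡⟨ tabulate∘lookup bs ⟩
  bs                          ∎)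

module _ (X : Graph) where

  private
    connected? : ∀ x z → Dec (Connected X x z)
    connected? = star? (Adj X) (adj? X)

    edgeAt? : ∀ x u v → Dec (Connected X x u × Adj X u v)
    edgeAt? x u v = connected? x u ×-dec adj? X u v

  -- For an edge only the first endpoint is required to be reachable: the second then is too, and
  -- vertices outside the class get empty neighbour sets, as `edge⇒vertex` demands.
  componentOf : V X → RawSubgraph (order X)
  componentOf x = raw (tabulate (does ∘ connected? x))
                      (tabulate λ u → tabulate (does ∘ edgeAt? x u))

  ∈-componentOf : ∀ {x z} → z ∈ vertices (componentOf x) ⇔ Connected X x z
  ∈-componentOf = ∈-tabulate (connected? _)

  edge-componentOf : ∀ {x u v} → Edge (componentOf x) u v ⇔ (Connected X x u × Adj X u v)
  edge-componentOf {x} {u} {v} =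
    subst (λ S → v ∈ S ⇔ (Connected X x u × Adj X u v))
          (sym (lookup∘tabulate (λ w → tabulate (does ∘ edgeAt? x w)) u))
          (∈-tabulate (edgeAt? x u))

  self∈componentOf : ∀ x → x ∈ vertices (componentOf x)
  self∈componentOf x = from ∈-componentOf ε

  componentOf-isConnectedSubgraph : ∀ x → IsConnectedSubgraph X (componentOf x)
  componentOf-isConnectedSubgraph x = record
    { nonempty    = x , self∈componentOf x
    ; edge⇒adj    = λ u v e → proj₂ (to edge-componentOf e)
    ; edge⇒vertex = λ u v e → from ∈-componentOf (proj₁ (to edge-componentOf e))
    ; edge-sym    = λ u v e → let p , a = to edge-componentOf e in
                      from edge-componentOf (p ◅◅ a ◅ ε , adj-sym X a)
    ; loops       = λ u u∈ → from edge-componentOf (to ∈-componentOf u∈ , adj-refl X)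
    } , λ u v u∈ v∈ → lift (to ∈-componentOf u∈)
          (connected-sym X (to ∈-componentOf u∈) ◅◅ to ∈-componentOf v∈)
    where
    -- The walk from `x` to the current vertex is carried along, because each edge of
    -- `componentOf x` needs its start to be reachable.
    lift : ∀ {u v} → Connected X x u → Connected X u v → Star (Edge (componentOf x)) u v
    lift p ε       = ε
    lift p (a ◅ q) = from edge-componentOf (p , a) ◅ lift (p ◅◅ a ◅ ε) q

  -- Connectedness joins `x` to every vertex of `H` by a walk inside `H`, which is also a walk in
  -- `X`.
  ⊑-componentOf : ∀ {H x} → IsConnectedSubgraph X H → x ∈ vertices H → H ⊑ componentOf x
  ⊑-componentOf {H} {x} (sub , conn) x∈ =
    (λ z∈ → from ∈-componentOf (walk z∈)) ,
    (λ u e → from edge-componentOf (walk (edge⇒vertex u _ e) , edge⇒adj u _ e))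
    where
    open IsSubgraph sub
    walk : ∀ {z} → z ∈ vertices H → Connected X x z
    walk z∈ = mapStar (edge⇒adj _ _) (conn _ _ x∈ z∈)

  componentOf-isComponent : ∀ x → IsComponent X (componentOf x)
  componentOf-isComponent x = componentOf-isConnectedSubgraph x ,
    λ K K-conn ⊑K → ⊑-antisym ⊑K (⊑-componentOf K-conn (proj₁ ⊑K (self∈componentOf x)))

  component≡componentOf : ∀ {H x} → IsComponentOf X x H → H ≡ componentOf x
  component≡componentOf ((conn , maximal) , x∈) =
    maximal _ (componentOf-isConnectedSubgraph _) (⊑-componentOf conn x∈)

  component-unique : ∀ {H K x} → IsComponentOf X x H → IsComponentOf X x K → H ≡ K
  component-unique p q = trans (component≡componentOf p) (sym (component≡componentOf q))

  -- This trades maximality for reachability: any vertex of a component serves as base point for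
  -- membership in it.
  ∈-component : ∀ {H x z} → IsComponentOf X x H → z ∈ vertices H ⇔ Connected X x z
  ∈-component p = subst (λ K → _ ∈ vertices K ⇔ _) (sym (component≡componentOf p)) ∈-componentOf

  -- Enumeration of the components

  component : Fin (c X) → RawSubgraph (order X)
  component = lookup (components X)

  component-isComponent : ∀ j → IsComponent X (component j)
  component-isComponent j = ∈-components⁻ X (∈-lookup j)

  component-injective : Injective _≡_ _≡_ component
  component-injective = lookup-injective (components-unique X)

  component-surjective : ∀ {H} → IsComponent X H → ∃[ j ] component j ≡ H
  component-surjective H-comp = index H∈ , sym (lookup-index H∈)
    where H∈ = ∈-components⁺ X H-comp

  componentIndex : ∀ x → ∃[ j ] x ∈ vertices (component j)
  componentIndex x = let j , eq = component-surjective (componentOf-isComponent x) in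
    j , subst (λ K → x ∈ vertices K) (sym eq) (self∈componentOf x)

  -- The class of `x` is listed, and listed components through `x` agree as subgraphs, hence as
  -- indices because the list has no repetitions.
  components-partition : ∀ x → sum (λ j → 𝟙 (x ∈? vertices (component j))) ≡ 1
  components-partition x = let i , x∈ = componentIndex x in
    sum-𝟙-unique (λ j → x ∈? vertices (component j)) i x∈ λ j x∈′ →
      component-injective
        (component-unique (component-isComponent j , x∈′) (component-isComponent i , x∈))

  -- Each vertex of the fibre is charged to the one component containing it; then the order of
  -- summation is exchanged.
  k-whole≡sum : (φ : V X → Fin n) (y : Fin n) →
                k φ (whole X) y ≡ sum (λ j → k φ (component j) y)
  k-whole≡sum φ y = begin
    k φ (whole X) y                                         ≡⟨ k≡sum φ (whole X) y ⟩
    sum (λ x → 𝟙 (x ∈? ⊤) * 𝟙 (φ x ≟ y))                   ≡⟨ sum-cong-≗ split ⟩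
    sum (λ x → sum (λ j → ι x j * 𝟙 (φ x ≟ y)))            ≡⟨ ∑-comm (λ x j → ι x j * 𝟙 (φ x ≟ y)) ⟩
    sum (λ j → sum (λ x → ι x j * 𝟙 (φ x ≟ y)))            ≡⟨ sum-cong-≗ (λ j → k≡sum φ (component j) y) ⟨
    sum (λ j → k φ (component j) y)                         ∎
    where
    ι : V X → Fin (c X) → ℕ
    ι x j = 𝟙 (x ∈? vertices (component j))

    split : ∀ x → 𝟙 (x ∈? ⊤) * 𝟙 (φ x ≟ y) ≡ sum (λ j → ι x j * 𝟙 (φ x ≟ y))
    split x = begin
      𝟙 (x ∈? ⊤) * 𝟙 (φ x ≟ y)              ≡⟨ cong (_* _) (𝟙-true (x ∈? ⊤) ∈⊤) ⟩
      1 * 𝟙 (φ x ≟ y)                        ≡⟨ cong (_* _) (components-partition x) ⟨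
      sum (ι x) * 𝟙 (φ x ≟ y)               ≡⟨ *-distribʳ-sum (𝟙 (φ x ≟ y)) (ι x) ⟩
      sum (λ j → ι x j * 𝟙 (φ x ≟ y))       ∎

-- Components over an orbit homomorphism

module _ {X : Graph} {G : Pred (Permutation′ (order X)) 0ℓ} (G-sub : IsSubgroupOfAut X G) where
  open IsSubgroupOfAut G-sub

  transport : ∀ {π x z} → G π → Connected X x z → Connected X (π ⟨$⟩ʳ x) (π ⟨$⟩ʳ z)
  transport {π} Gπ = gmap (π ⟨$⟩ʳ_) λ {u} {v} → to (automorphism Gπ u v)

  -- The inverse of `π` also lies in `G` and carries walks back.
  connected-⇔ : ∀ {π x z} → G π → Connected X x z ⇔ Connected X (π ⟨$⟩ʳ x) (π ⟨$⟩ʳ z)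
  connected-⇔ {π} Gπ = mk⇔ (transport Gπ) λ p →
    subst₂ (Connected X) (inverseˡ π) (inverseˡ π) (transport (flip-closed Gπ) p)

module OrbitHomomorphism (X Y : Graph) (φ : V X → V Y) (hom : IsHomomorphism X Y φ)
  (complete : IsComplete X Y φ) {G : Pred (Permutation′ (order X)) 0ℓ}
  (G-sub : IsSubgroupOfAut X G)
  (orbits : (S : Subset (order X)) →
    (Nonempty S × ∃[ y ] S ≡ fibre φ y) ⇔ (∃[ x ] (_∈ S) ≐ Orbit G x)) where

  open IsComplete complete
  open IsSubgroupOfAut G-sub

  private
    -- This fibre contains `x`, so it is one of the nonempty fibres. The base point `x₀` of the
    -- orbit need not be `x`.
    fibre-orbit : ∀ x → ∃[ x₀ ] (_∈ fibre φ (φ x)) ≐ Orbit G x₀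
    fibre-orbit x = to (orbits (fibre φ (φ x))) ((x , from (∈-fibre φ) refl) , φ x , refl)

  fibre⇒orbit : ∀ {x x′} → φ x ≡ φ x′ → Orbit G x x′
  fibre⇒orbit {x} {x′} eq =
    let x₀ , into , _    = fibre-orbit x
        π , Gπ , πx₀≡x   = into (from (∈-fibre φ) refl)
        ρ , Gρ , ρx₀≡x′  = into (from (∈-fibre φ) (sym eq))
    -- `_∘ₚ_` applies its left factor first: from `x` back to `x₀`, then on to `x′`.
    in flip π ∘ₚ ρ , ∘-closed (flip-closed Gπ) Gρ ,
       trans (cong (λ z → ρ ⟨$⟩ʳ (flip π ⟨$⟩ʳ z)) (sym πx₀≡x))
             (trans (cong (ρ ⟨$⟩ʳ_) (inverseˡ π)) ρx₀≡x′)

  -- Moving `x₀` by `ρ` and then `π` stays in its orbit, and this orbit is the whole fibre through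
  -- `x`.
  φ-invariant : ∀ {π} → G π → ∀ x → φ (π ⟨$⟩ʳ x) ≡ φ x
  φ-invariant {π} Gπ x =
    let x₀ , into , out = fibre-orbit x
        ρ , Gρ , ρx₀≡x  = into (from (∈-fibre φ) refl)
    in to (∈-fibre φ) (out (_ , ∘-closed Gρ Gπ , cong (π ⟨$⟩ʳ_) ρx₀≡x))

  -- Lifting edges and walks along `φ`

  lift-adj : ∀ {x y} → Adj Y (φ x) y → ∃[ x′ ] Adj X x x′ × φ x′ ≡ y
  lift-adj {x} a =
    -- Completeness yields an edge over the given one, but starting at some `x₁` in the fibre of
    -- `x`. An element of `G` moves `x₁` to `x` and keeps the other end over `y`.
    let x₁ , x₂ , x₁~x₂ , φx₁≡φx , φx₂≡y = onto-E a
        π , Gπ , πx₁≡x = fibre⇒orbit φx₁≡φx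
    in π ⟨$⟩ʳ x₂ ,
       subst (λ z → Adj X z (π ⟨$⟩ʳ x₂)) πx₁≡x (to (automorphism Gπ x₁ x₂) x₁~x₂) ,
       trans (φ-invariant Gπ x₂) φx₂≡y

  lift-walk : ∀ {x y y′} → φ x ≡ y → Connected Y y y′ → ∃[ x′ ] Connected X x x′ × φ x′ ≡ y′
  lift-walk eq   ε       = _ , ε , eq
  lift-walk refl (a ◅ p) =
    let _  , b , eq  = lift-adj a
        x′ , q , eq′ = lift-walk eq p
    in x′ , b ◅ q , eq′

  -- Components meeting a fibre

  Meets : RawSubgraph (order X) → V Y → Set
  Meets H y = Nonempty (vertices H ∩ fibre φ y)

  meets? : ∀ H y → Dec (Meets H y)
  meets? H y = nonempty? (vertices H ∩ fibre φ y)

  meets⁺ : ∀ H {y x} → x ∈ vertices H → φ x ≡ y → Meets H y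
  meets⁺ H x∈ eq = _ , x∈p∩q⁺ (x∈ , from (∈-fibre φ) eq)

  meets⁻ : ∀ H y → Meets H y → ∃[ x ] x ∈ vertices H × φ x ≡ y
  meets⁻ H y (x , x∈) = let a , b = x∈p∩q⁻ (vertices H) (fibre φ y) x∈ in x , a , to (∈-fibre φ) b

  k≡0 : ∀ H y → ¬ Meets H y → k φ H y ≡ 0
  k≡0 H y ¬meets = trans (cong ∣_∣ (Empty-unique ¬meets)) (∣⊥∣≡0 (order X))

  k>0⇒meets : ∀ H y → 0 < k φ H y → Meets H y
  k>0⇒meets H y k>0 with meets? H y
  ... | yes p = p
  ... | no ¬p = contradiction (subst (0 <_) (k≡0 H y ¬p) k>0) n≮0

  meets-connected : ∀ H {y y′} → IsComponent X H → Meets H y → Meets H y′ → Connected Y y y′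
  meets-connected H {y} {y′} H-comp p p′ with meets⁻ H y p | meets⁻ H y′ p′
  ... | x , x∈ , refl | x′ , x′∈ , refl = gmap φ hom (to (∈-component X (H-comp , x∈)) x′∈)

  -- The walk lifted from `x` cannot leave the component of `x`, so its endpoint over `y` lies in
  -- `H`.
  connected⇒meets : ∀ H {x y} → IsComponentOf X x H → Connected Y (φ x) y → Meets H y
  connected⇒meets H H-compOf p = let _ , q , eq = lift-walk refl p in
    meets⁺ H (from (∈-component X H-compOf) q) eq

  -- Some `π` in `G` takes a vertex of `H` over `y` to one of `K` over `y`. It carries `H` onto `K`
  -- and preserves the fibre, so reindexing the sum by `π` turns one count into the other.
  k-equal : ∀ H K {y} → IsComponent X H → IsComponent X K →
            Meets H y → Meets K y → k φ H y ≡ k φ K y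
  k-equal H K {y} H-comp K-comp p q = begin
    k φ H y                                                              ≡⟨ k≡sum φ H y ⟩
    sum (λ z → 𝟙 (z ∈? vertices H) * 𝟙 (φ z ≟ y))                       ≡⟨ sum-cong-≗ move ⟩
    sum (λ z → 𝟙 (π ⟨$⟩ʳ z ∈? vertices K) * 𝟙 (φ (π ⟨$⟩ʳ z) ≟ y))       ≡⟨ sum-permute (λ z → 𝟙 (z ∈? vertices K) * 𝟙 (φ z ≟ y)) π ⟨
    sum (λ z → 𝟙 (z ∈? vertices K) * 𝟙 (φ z ≟ y))                       ≡⟨ k≡sum φ K y ⟨
    k φ K y                                                              ∎
    where
    x = proj₁ (meets⁻ H y p)
    x∈ = proj₁ (proj₂ (meets⁻ H y p))
    x′∈ = proj₁ (proj₂ (meets⁻ K y q))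
    x~x′ = fibre⇒orbit (trans (proj₂ (proj₂ (meets⁻ H y p))) (sym (proj₂ (proj₂ (meets⁻ K y q)))))
    π = proj₁ x~x′
    Gπ = proj₁ (proj₂ x~x′)

    ∈-move : ∀ z → z ∈ vertices H ⇔ π ⟨$⟩ʳ z ∈ vertices K
    ∈-move z = mk⇔
      (λ z∈ → from K⇔ (to step (to H⇔ z∈)))
      (λ z∈ → from H⇔ (from step (to K⇔ z∈)))
      where
      H⇔ : z ∈ vertices H ⇔ Connected X x z
      H⇔ = ∈-component X (H-comp , x∈)
      step : Connected X x z ⇔ Connected X (π ⟨$⟩ʳ x) (π ⟨$⟩ʳ z)
      step = connected-⇔ G-sub Gπ
      K⇔ : π ⟨$⟩ʳ z ∈ vertices K ⇔ Connected X (π ⟨$⟩ʳ x) (π ⟨$⟩ʳ z)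
      K⇔ = ∈-component X (K-comp , subst (_∈ vertices K) (sym (proj₂ (proj₂ x~x′))) x′∈)

    move : ∀ z → 𝟙 (z ∈? vertices H) * 𝟙 (φ z ≟ y)
               ≡ 𝟙 (π ⟨$⟩ʳ z ∈? vertices K) * 𝟙 (φ (π ⟨$⟩ʳ z) ≟ y)
    move z = cong₂ _*_
      (𝟙-cong (∈-move z) (z ∈? vertices H) (π ⟨$⟩ʳ z ∈? vertices K))
      (cong (λ w → 𝟙 (w ≟ y)) (sym (φ-invariant Gπ z)))

  componentsMeeting : V Y → ℕ
  componentsMeeting y = sum (λ j → 𝟙 (meets? (component X j) y))

  -- Components missing the fibre contribute 0, and by `k-equal` every other one contributes as much
  -- as `H`.
  k-whole≡componentsMeeting*k : ∀ {H y} → IsComponentMeeting X Y φ y H →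
    k φ (whole X) y ≡ componentsMeeting y * k φ H y
  k-whole≡componentsMeeting*k {H} {y} (H-comp , k>0) = begin
    k φ (whole X) y                                          ≡⟨ k-whole≡sum X φ y ⟩
    sum (λ j → k φ (component X j) y)                        ≡⟨ sum-cong-≗ term ⟩
    sum (λ j → 𝟙 (meets? (component X j) y) * k φ H y)      ≡⟨ *-distribʳ-sum (k φ H y) (λ j → 𝟙 (meets? (component X j) y)) ⟨
    componentsMeeting y * k φ H y                            ∎
    where
    term : ∀ j → k φ (component X j) y ≡ 𝟙 (meets? (component X j) y) * k φ H y
    term j with meets? (component X j) y
    ... | yes p = trans (k-equal (component X j) H (component-isComponent X j) H-comp p (k>0⇒meets H y k>0))
                        (sym (*-identityˡ (k φ H y)))
    ... | no ¬p = k≡0 (component X j) y ¬p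

  -- Representatives of the components of `Y`

  module _ (y : Fin (c Y) → V Y)
    (reps : ∀ K → IsComponent Y K ⇔ (∃[ i ] IsComponentOf Y (y i) K)) where

    -- c(Y) points represent c(Y) components, so none is represented twice.
    representatives-injective : ∀ {i i′} → Connected Y (y i) (y i′) → i ≡ i′
    representatives-injective {i} {i′} p =
      let j  , compOf  , eq  = surj i
          j′ , compOf′ , eq′ = surj i′
          yi′∈j = from (∈-component Y compOf) p
          j≡j′  = component-injective Y (component-unique Y (proj₁ compOf , yi′∈j) compOf′)
      in trans (sym eq) (trans (cong (proj₁ ∘ rep) j≡j′) eq′)
      where
      rep : ∀ j → ∃[ i ] IsComponentOf Y (y i) (component Y j)
      rep j = to (reps _) (component-isComponent Y j)

      -- A shared representative would lie in both components, which then coincide.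
      rep-injective : Injective _≡_ _≡_ (proj₁ ∘ rep)
      rep-injective {j} {j′} eq = component-injective Y (component-unique Y (proj₂ (rep j))
        (subst (λ i → IsComponentOf Y (y i) (component Y j′)) (sym eq) (proj₂ (rep j′))))

      surj : ∀ i → ∃[ j ] IsComponentOf Y (y i) (component Y j) × proj₁ (rep j) ≡ i
      -- As `rep` goes from `Fin (c Y)` to itself, injectivity makes every index the chosen one for
      -- some component.
      surj i = let j , eq = injective⇒strictlySurjective rep-injective i in
        j , subst (λ i → IsComponentOf Y (y i) (component Y j)) eq (proj₂ (rep j)) , eq

    -- Existence: the image of any vertex of the component is connected to some representative, and
    -- the walk lifts. Uniqueness: two representatives met by the component are connected in `Y`.
    component-meets-one : ∀ j → sum (λ i → 𝟙 (meets? (component X j) (y i))) ≡ 1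
    component-meets-one j =
      let j-comp          = component-isComponent X j
          x , x∈          = IsSubgraph.nonempty (proj₁ (proj₁ j-comp))
          i , compOf      = to (reps _) (componentOf-isComponent Y (φ x))
          p : Meets (component X j) (y i)
          p               = connected⇒meets (component X j) (j-comp , x∈) (to (∈-componentOf Y) (proj₂ compOf))
      in sum-𝟙-unique (λ i → meets? (component X j) (y i)) i p
           λ i′ p′ → representatives-injective (meets-connected (component X j) j-comp p′ p)

    -- Double counting of the pairs of a component of `X` and an index whose fibre it meets.
    c≡sum-componentsMeeting : c X ≡ sum (componentsMeeting ∘ y)
    c≡sum-componentsMeeting = begin
      c X                                                            ≡⟨ sum-1 (c X) ⟨
      sum {c X} (λ _ → 1)                                            ≡⟨ sum-cong-≗ component-meets-one ⟨
      sum (λ j → sum (λ i → 𝟙 (meets? (component X j) (y i))))      ≡⟨ ∑-comm (λ j i → 𝟙 (meets? (component X j) (y i))) ⟩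
      sum (componentsMeeting ∘ y)                                    ∎

theoremB : (X Y : Graph) (φ : V X → V Y) →
    IsHomomorphism X Y φ →
    IsComplete X Y φ →
    IsOrbit X Y φ →
    (y : Fin (c Y) → V Y) →
    (∀ K → IsComponent Y K ⇔ (∃[ i ] IsComponentOf Y (y i) K)) →
    (C : Fin (c Y) → RawSubgraph (order X)) →
    (C∈ : ∀ i → IsComponentMeeting X Y φ (y i) (C i)) →
    (+ c X) / 1 ≡
    sumℚ (λ i → _/_ (+ k φ (whole X) (y i)) (k φ (C i) (y i)) {{>-nonZero (proj₂ (C∈ i))}})
theoremB X Y φ hom complete (G , G-sub , orbits) y reps C C∈ = begin
  fromℕ (c X)                                 ≡⟨ cong fromℕ (c≡sum-componentsMeeting y reps) ⟩
  fromℕ (sum (componentsMeeting ∘ y))         ≡⟨ fromℕ-sum (componentsMeeting ∘ y) ⟩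
  sumℚ (fromℕ ∘ componentsMeeting ∘ y)        ≡⟨ sumℚ-cong quotient ⟨
  sumℚ (λ i → _/_ (+ k φ (whole X) (y i)) (k φ (C i) (y i)) {{>-nonZero (proj₂ (C∈ i))}}) ∎
  where
  open OrbitHomomorphism X Y φ hom complete G-sub orbits

  quotient : ∀ i → _/_ (+ k φ (whole X) (y i)) (k φ (C i) (y i)) {{>-nonZero (proj₂ (C∈ i))}}
                 ≡ fromℕ (componentsMeeting (y i))
  quotient i = trans
    -- Only the numerator is rewritten, so the denominator and its nonzero proof stay fixed;
    -- afterwards the division is exact.
    (cong (λ a → _/_ (+ a) (k φ (C i) (y i)) {{k≢0}}) (k-whole≡componentsMeeting*k (C∈ i)))
    (m*n/n≡fromℕ-m (componentsMeeting (y i)) (k φ (C i) (y i)) {{k≢0}})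
    where
    k≢0 : NonZero (k φ (C i) (y i))
    k≢0 = >-nonZero (proj₂ (C∈ i))
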